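{- Let $A_n(x)$ denote the classical Eulerian polynomials. For every $n\geqslant 1$, the derivative of $A_n(x)$ equals the $n\times n$ determinant $$\frac{\mathrm{d}}{\mathrm{d}x} A_n(x)= \begin{vmatrix} 1 & -1 & 0 & 0 & \cdots & 0\\ A_1(x) & 1+x & -1 & 0 & \cdots & 0\\ A_2(x) & 2\binom{2}{1}A_1(x) & 1+x & -1 & \cdots & 0\\ A_3(x) & 2\binom{3}{1}A_2(x) & 2\binom{3}{2}A_1(x) & 1+x & \cdots & 0\\ \vdots & \vdots & \vdots & \vdots & \ddots & -1\\ A_{n-1}(x) & 2\binom{n-1}{1}A_{n-2}(x) & 2\binom{n-1}{2}A_{n-3}(x) & 2\binom{n-1}{3}A_{n-4}(x) & \cdots & 1+x \end{vmatrix},$$ that is, the determinant of the matrix whose $(i,1)$ entry is $A_{i-1}(x)$ for $1\leqslant i\leqslant n$ (with $A_0(x)=1$), whose $(i,i)$ entry is $1+x$ for $2\leqslant i\leqslant n$, whose $(i,j)$ entry is $2\binom{i-1}{j-1}A_{i-j}(x)$ for $2\leqslant j<i\leqslant n$, whose $(i,i+1)$ entries are $-1$, and whose $(i,j)$ entries with $j>i+1$ are $0$.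
   Context: The classical Eulerian polynomials $A_n(x)$ are defined by $A_0(x)=1$ and $A_n(x)=nxA_{n-1}(x)+x(1-x)\frac{\mathrm{d}}{\mathrm{d}x}A_{n-1}(x)$ for $n\geqslant 1$. Equivalently, for $n\geqslant 1$, $A_n(x)=\sum_{\pi\in\mathfrak{S}_n}x^{\mathrm{des}(\pi)}$, where $\mathfrak{S}_n$ is the set of permutations $\pi=\pi_1\pi_2\cdots\pi_n$ of $\{1,\ldots,n\}$ and $\mathrm{des}(\pi)$ is the number of indices $i\in\{1,\ldots,n\}$ with $\pi_i>\pi_{i+1}$, with the convention $\pi_{n+1}=0$. -}

module Defs where

open import Algebra.Bundles using (RawRing)
import Algebra.Definitions.RawSemiring as RawSemiringDefs
open import Data.Bool.Base using (if_then_else_)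
open import Data.Fin.Base using (Fin; zero; suc; toℕ; punchIn)
open import Data.Integer.Base as ℤ using (ℤ; +_; 0ℤ; 1ℤ)
open import Data.List.Base using (List; []; _∷_; map)
open import Data.Nat.Base as ℕ using (ℕ; zero; suc; _∸_; _<ᵇ_; _≡ᵇ_)
open import Data.Nat.Combinatorics using (_C_)
open import Level using (0ℓ)
open import Relation.Binary.PropositionalEquality using (_≡_)

-- ℤ[x]: a polynomial is its list of coefficients, constant term first.
-- Trailing zeros are allowed, so equality of polynomials is _≈_, not _≡_.

Poly : Set
Poly = List ℤ

coeff : Poly → ℕ → ℤ
coeff []      _       = 0ℤ
coeff (a ∷ p) zero    = a
coeff (a ∷ p) (suc k) = coeff p k

infix  4 _≈_
infixl 6 _+_ _-_
infixl 7 _*_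
infixr 7 _·_
infix  8 -_

_≈_ : Poly → Poly → Set
p ≈ q = ∀ k → coeff p k ≡ coeff q k

0ₚ 1ₚ X : Poly
0ₚ = []
1ₚ = 1ℤ ∷ []
X  = 0ℤ ∷ 1ℤ ∷ []

_+_ : Poly → Poly → Poly
[]      + q       = q
(a ∷ p) + []      = a ∷ p
(a ∷ p) + (b ∷ q) = (a ℤ.+ b) ∷ (p + q)

-_ : Poly → Poly
-_ = map (λ a → ℤ.- a)

_-_ : Poly → Poly → Poly
p - q = p + (- q)

_·_ : ℤ → Poly → Poly
c · p = map (c ℤ.*_) p

-- (a + x p) q = a q + x (p q)
_*_ : Poly → Poly → Poly
[]      * q = []
(a ∷ p) * q = (a · q) + (0ℤ ∷ (p * q))

ℤ[x] : RawRing 0ℓ 0ℓ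
ℤ[x] = record
  { Carrier = Poly
  ; _≈_     = _≈_
  ; _+_     = _+_
  ; _*_     = _*_
  ; -_      = -_
  ; 0#      = 0ₚ
  ; 1#      = 1ₚ
  }

-- weighted k (a₀ ∷ a₁ ∷ …) = k a₀ ∷ (k + 1) a₁ ∷ …
weighted : ℕ → Poly → Poly
weighted k []      = []
weighted k (a ∷ p) = (+ k ℤ.* a) ∷ weighted (suc k) p

-- d/dx (a₀ + a₁ x + a₂ x² + …) = 1 a₁ + 2 a₂ x + …
deriv : Poly → Poly
deriv []      = []
deriv (_ ∷ p) = weighted 1 p

-- Laplace expansion along the first row; λ r c → M (suc r) (punchIn j c)
-- deletes row 0 and column j.
module Determinant {c ℓ} (R : RawRing c ℓ) where
  open RawRing R using (Carrier; rawSemiring; 1#)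
    renaming (_*_ to _*ᴿ_; -_ to -ᴿ_)
  open RawSemiringDefs rawSemiring using (_^_; sum)

  det : ∀ {n} → (Fin n → Fin n → Carrier) → Carrier
  det {zero}  M = 1#
  det {suc n} M = sum λ j →
    ((-ᴿ 1#) ^ toℕ j) *ᴿ (M zero j *ᴿ det (λ r c → M (suc r) (punchIn j c)))

open Determinant ℤ[x] public using (det)

eulerian : ℕ → Poly
eulerian zero      = 1ₚ
eulerian n@(suc m) =
  + n · (X * eulerian m) + (X * (1ₚ - X)) * deriv (eulerian m)

-- Rows and columns are counted from 0, so entry i j is the (i + 1, j + 1)
-- entry of the usual 1-based matrix; i - j is unaffected by the shift, and the
-- binomial coefficient (i+1)-1 over (j+1)-1 becomes i C j.
entry : ℕ → ℕ → Poly
entry i zero      = eulerian i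
entry i j@(suc _) =
  if j <ᵇ i      then + (2 ℕ.* (i C j)) · eulerian (i ∸ j) else
  if j ≡ᵇ i      then 1ₚ + X else
  if j ≡ᵇ suc i  then - 1ₚ
                 else 0ₚ

eulerianMatrix : ∀ n → Fin n → Fin n → Poly
eulerianMatrix n i j = entry (toℕ i) (toℕ j)

module Submission where

-- A Hessenberg matrix M with superdiagonal -1 has leading principal minors
-- D_{n+1} = Σ_{j≤n} M_{n,j} D_j, so it suffices that the derivatives A_j′
-- satisfy the same recurrence.  It is obtained by differentiating
--   A_{n+1} + (1 - x) A_n = Σ_j (n choose j) A_j A_{n-j},
-- the coefficient form of F_z = F² - (1 - x) F for the exponential generating
-- function F of the A_n.  The difference G_n of the two sides satisfies
-- G_{n+1} = (n + 2) x G_n + x (1 - x) G_n′, and G_0 = 0.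

open import Algebra.Bundles using (CommutativeMonoid; CommutativeRing; RawRing)
import Algebra.Definitions.RawMonoid as RawMonoidDefs
open import Data.Fin.Base using (Fin; zero; suc; toℕ; punchIn)
open import Data.Fin.Properties using (toℕ-inject₁; toℕ-fromℕ; toℕ<n)
open import Data.Integer.Base as ℤ using (+_; 0ℤ; 1ℤ)
import Data.Integer.Properties as ℤ
open import Data.Integer.Solver using (module +-*-Solver)
open import Data.List.Base using ([]; _∷_)
open import Data.Nat.Base as ℕ using (ℕ; zero; suc; _∸_; _≥_)
open import Data.Nat.Combinatorics using (_C_; nCn≡1; nCk≡nC[n∸k]; k>n⇒nCk≡0; nCk+nC[k+1]≡[n+1]C[k+1])
open import Data.Nat.Induction using (<-rec)
import Data.Nat.Properties as ℕ
open import Data.Product.Base using (_,_)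
open import Function.Base using (flip)
open import Level using (_⊔_)
open import Relation.Binary.PropositionalEquality as ≡ using (_≡_)
open import Relation.Nullary.Decidable using (dec-true; dec-false)

open import Defs using (module Determinant)

-- Determinants of Hessenberg matrices with superdiagonal -1.

module HessenbergDeterminant {c ℓ} (R : CommutativeRing c ℓ) where
  open CommutativeRing R hiding (zero)
  open import Algebra.Properties.Ring ring using (-1*x≈-x; -‿involutive)
  open import Algebra.Properties.Semiring.Sum semiring
  open import Algebra.Solver.Ring.NaturalCoefficients.Default commutativeSemiring
  open import Relation.Binary.Reasoning.Setoid setoid
  open Determinant rawRing using (det)
  open RawRing rawRing using (rawSemiring)
  open import Algebra.Definitions.RawSemiring rawSemiring using (_^_)

  det-cong : ∀ {n} {M N : Fin n → Fin n → Carrier} →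
             (∀ i j → M i j ≈ N i j) → det M ≈ det N
  det-cong {zero}          M≈N = refl
  det-cong {suc n} {M} {N} M≈N = sum-cong-≋ {suc n} λ j →
    *-congˡ {(- 1#) ^ toℕ j} (*-cong (M≈N zero j) (det-cong λ r c → M≈N (suc r) (punchIn j c)))

  -- Infinite arrays carry all leading minors at once, and deleting a row and a column becomes a
  -- reindexing.
  Array : Set c
  Array = ℕ → ℕ → Carrier

  leading : Array → ℕ → Carrier
  leading M n = det {n} λ i j → M (toℕ i) (toℕ j)

  record IsHessenberg (M : Array) : Set ℓ where
    field
      superdiagonal : ∀ i → M i (suc i) ≈ - 1#
      beyond        : ∀ {i j} → suc i ℕ.< j → M i j ≈ 0#

  -- The two minors that survive in the expansion along row 0. They differ only in their column 0,
  -- and both are again Hessenberg.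
  dropColumn₀ dropColumn₁ : Array → Array
  dropColumn₀ M i j       = M (suc i) (suc j)
  dropColumn₁ M i zero    = M (suc i) zero
  dropColumn₁ M i (suc j) = M (suc i) (suc (suc j))

  module _ {M : Array} (H : IsHessenberg M) where
    open IsHessenberg H

    dropColumn₀-hessenberg : IsHessenberg (dropColumn₀ M)
    dropColumn₀-hessenberg = record
      { superdiagonal = λ i → superdiagonal (suc i)
      ; beyond        = λ i<j → beyond (ℕ.s≤s i<j)
      }

    dropColumn₁-hessenberg : IsHessenberg (dropColumn₁ M)
    dropColumn₁-hessenberg = record
      { superdiagonal = λ i → superdiagonal (suc i)
      ; beyond        = λ { {j = suc j} i<j → beyond (ℕ.s≤s i<j) }
      }

    -- Row 0 contributes only `M 0 0` and the superdiagonal entry -1, whose sign is cancelled by the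
    -- cofactor sign.
    leading-expand : ∀ n → leading M (suc (suc n)) ≈
      M 0 0 * leading (dropColumn₀ M) (suc n) + leading (dropColumn₁ M) (suc n)
    leading-expand n = +-cong (*-identityˡ _) (begin
      ((- 1#) * 1#) * (M 0 1 * det (minor (suc zero))) + sum rest
        ≈⟨ +-cong (*-cong (*-identityʳ _) (*-congʳ (superdiagonal 0))) rest≈0 ⟩
      (- 1#) * ((- 1#) * det (minor (suc zero))) + 0#
        ≈⟨ +-identityʳ _ ⟩
      (- 1#) * ((- 1#) * det (minor (suc zero)))
        ≈⟨ trans (-1*x≈-x _) (-‿cong (-1*x≈-x _)) ⟩
      - - det (minor (suc zero))
        ≈⟨ -‿involutive _ ⟩
      det (minor (suc zero))
        -- `punchIn (suc zero)` computes only once the column is split into zero and successor.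
        ≈⟨ det-cong {suc n} {minor (suc zero)} {λ i j → dropColumn₁ M (toℕ i) (toℕ j)}
             (λ { _ zero → refl ; _ (suc _) → refl }) ⟩
      leading (dropColumn₁ M) (suc n) ∎)
      where
      minor : Fin (suc (suc n)) → Fin (suc n) → Fin (suc n) → Carrier
      minor j r c = M (toℕ (suc r)) (toℕ (punchIn j c))

      rest : Fin n → Carrier
      rest j = ((- 1#) ^ toℕ (suc (suc j))) *
               (M 0 (toℕ (suc (suc j))) * det (minor (suc (suc j))))

      rest≈0 : sum rest ≈ 0#
      rest≈0 = trans
        (sum-cong-≋ {n} λ j → trans
          (*-congˡ (trans (*-congʳ (beyond (ℕ.s≤s (ℕ.s≤s ℕ.z≤n)))) (zeroˡ _)))
          (zeroʳ _))
        (sum-replicate-zero n)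

  -- Expanding along the first row keeps the last row intact, so the
  -- expansion along the last row follows by induction.
  leading-recurrence : ∀ n {M} → IsHessenberg M →
    leading M (suc n) ≈ ∑[ j ≤ n ] (M n (toℕ j) * leading M (toℕ j))
  leading-recurrence zero            H = +-congʳ (*-identityˡ _)
  leading-recurrence (suc n) {M = M} H = begin
    leading M (suc (suc n))
      ≈⟨ leading-expand H n ⟩
    a * leading M₀ (suc n) + leading M₁ (suc n)
      ≈⟨ +-cong (*-congˡ (leading-recurrence n (dropColumn₀-hessenberg H)))
                (leading-recurrence n (dropColumn₁-hessenberg H)) ⟩
    a * (p * 1# + sum s₀) + (q * 1# + sum s₁)
      -- Isolates the terms j = 0 and j = 1 of the target sum; `con 1 :* (a :* con 1) :+ con 0` is
      -- `leading M 1` unfolded.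
      ≈⟨ solve 5 (λ a p q s t → a :* (p :* con 1 :+ s) :+ (q :* con 1 :+ t) :=
                   q :* con 1 :+ (p :* (con 1 :* (a :* con 1) :+ con 0) :+ (a :* s :+ t)))
               refl a p q (sum s₀) (sum s₁) ⟩
    q * 1# + (p * leading M 1 + (a * sum s₀ + sum s₁))
      ≈⟨ +-congˡ (+-congˡ tails) ⟩
    q * 1# + (p * leading M 1 + sum s) ∎
    where
    M₀ M₁ : Array
    M₀ = dropColumn₀ M
    M₁ = dropColumn₁ M

    a p q : Carrier
    a = M 0 0
    p = M (suc n) 1
    q = M (suc n) 0

    m s₀ s₁ s : Fin n → Carrier
    m  j = M (suc n) (suc (suc (toℕ j)))
    s₀ j = m j * leading M₀ (suc (toℕ j))
    s₁ j = m j * leading M₁ (suc (toℕ j))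
    s  j = m j * leading M (suc (suc (toℕ j)))

    -- Beyond column 1 both minors have the same last-row entry `m j`, so `leading-expand` read
    -- backwards merges the two sums.
    tails : a * sum s₀ + sum s₁ ≈ sum s
    tails = begin
      a * sum s₀ + sum s₁
        ≈⟨ +-congʳ (*-distribˡ-sum a s₀) ⟩
      sum (λ j → a * s₀ j) + sum s₁
        ≈⟨ ∑-distrib-+ (λ j → a * s₀ j) s₁ ⟨
      sum (λ j → a * s₀ j + s₁ j)
        ≈⟨ sum-cong-≋ {n} (λ j → trans
             (solve 4 (λ a m u v → a :* (m :* u) :+ m :* v := m :* (a :* u :+ v))
                    refl a (m j) (leading M₀ (suc (toℕ j))) (leading M₁ (suc (toℕ j))))
             (*-congˡ (sym (leading-expand H (toℕ j))))) ⟩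
      sum s ∎

-- Binomial convolutions in a commutative monoid.

module BinomialConvolution {c ℓ} (M : CommutativeMonoid c ℓ) where
  open CommutativeMonoid M
    renaming (_∙_ to _+_; ε to 0#; ∙-cong to +-cong; ∙-congˡ to +-congˡ; ∙-congʳ to +-congʳ;
              identityˡ to +-identityˡ; identityʳ to +-identityʳ; assoc to +-assoc; comm to +-comm)
  open import Algebra.Properties.CommutativeMonoid.Sum M
  open import Algebra.Properties.CommutativeMonoid.Mult M
  open import Algebra.Properties.CommutativeSemigroup commutativeSemigroup using (interchange; x∙yz≈y∙xz)
  open import Relation.Binary.Reasoning.Setoid setoid

  -- Σ_{i+j=n} (n choose i) h i j, by Pascal's rule; see convolution-∑.
  convolution : ℕ → (ℕ → ℕ → Carrier) → Carrier
  convolution zero    h = h 0 0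
  convolution (suc n) h =
    convolution n (λ i j → h (suc i) j) + convolution n (λ i j → h i (suc j))

  -- Equality is required only on the antidiagonal, so a weight depending on `i + j` may be replaced
  -- by a constant, as `S-suc` does.
  convolution-cong : ∀ n {g h} → (∀ i j → i ℕ.+ j ≡ n → g i j ≈ h i j) →
                     convolution n g ≈ convolution n h
  convolution-cong zero    g≈h = g≈h 0 0 ≡.refl
  convolution-cong (suc n) g≈h = +-cong
    (convolution-cong n λ i j i+j≡n → g≈h (suc i) j (≡.cong suc i+j≡n))
    (convolution-cong n λ i j i+j≡n → g≈h i (suc j) (≡.trans (ℕ.+-suc i j) (≡.cong suc i+j≡n)))

  convolution-+ : ∀ n g h →
    convolution n (λ i j → g i j + h i j) ≈ convolution n g + convolution n h
  convolution-+ zero    g h = refl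
  convolution-+ (suc n) g h = trans
    (+-cong (convolution-+ n _ _) (convolution-+ n _ _)) (interchange _ _ _ _)

  -- A convolution is an iterated sum of values of `h`, so an additive map passes through it.
  -- Applied to `step` and to `∂`.
  convolution-homo : ∀ (φ : Carrier → Carrier) → (∀ x y → φ (x + y) ≈ φ x + φ y) → ∀ n h →
    φ (convolution n h) ≈ convolution n (λ i j → φ (h i j))
  convolution-homo φ φ-+ zero    h = refl
  convolution-homo φ φ-+ (suc n) h = trans
    (φ-+ _ _) (+-cong (convolution-homo φ φ-+ n _) (convolution-homo φ φ-+ n _))

  -- Flipping the indices exchanges the two summands of the recursion.
  convolution-flip : ∀ n h → convolution n (flip h) ≈ convolution n h
  convolution-flip zero    h = refl
  convolution-flip (suc n) h = trans
    (+-cong (convolution-flip n _) (convolution-flip n _)) (+-comm _ _)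

  ∑-last : ∀ n (f : ℕ → Carrier) → ∑[ j ≤ n ] f (toℕ j) ≈ ∑[ j < n ] f (toℕ j) + f n
  ∑-last n f = trans
    (sum-init-last {n} (λ j → f (toℕ j)))
    (+-cong (sum-cong-≋ {n} λ j → reflexive (≡.cong f (toℕ-inject₁ j)))
            (reflexive (≡.cong f (toℕ-fromℕ n))))

  term : ℕ → (ℕ → ℕ → Carrier) → ℕ → Carrier
  term n h j = (n C j) × h j (n ∸ j)

  -- Pascal's rule splits every term after the first. The parts with `n C j` form the sum for `hˡ`;
  -- the parts `u`, together with the first term, form the sum for `hʳ`.
  convolution-∑ : ∀ n h → convolution n h ≈ ∑[ j ≤ n ] term n h (toℕ j)
  convolution-∑ zero    h = sym (trans (+-identityʳ _) (+-identityʳ _))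
  convolution-∑ (suc n) h = sym (begin
    term (suc n) h 0 + ∑[ j ≤ n ] term (suc n) h (suc (toℕ j))
      ≈⟨ +-congˡ (sum-cong-≋ {suc n} (λ j → pascal (toℕ j))) ⟩
    term (suc n) h 0 + ∑[ j ≤ n ] (term n hˡ (toℕ j) + u (toℕ j))
      ≈⟨ +-congˡ (∑-distrib-+ (λ (j : Fin (suc n)) → term n hˡ (toℕ j)) (λ j → u (toℕ j))) ⟩
    term (suc n) h 0 + (∑[ j ≤ n ] term n hˡ (toℕ j) + ∑[ j ≤ n ] u (toℕ j))
      ≈⟨ x∙yz≈y∙xz _ _ _ ⟩
    ∑[ j ≤ n ] term n hˡ (toℕ j) + (term (suc n) h 0 + ∑[ j ≤ n ] u (toℕ j))
      ≈⟨ +-cong (sym (convolution-∑ n hˡ)) (trans boundary (sym (convolution-∑ n hʳ))) ⟩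
    convolution n hˡ + convolution n hʳ ∎)
    where
    hˡ hʳ : ℕ → ℕ → Carrier
    hˡ i j = h (suc i) j
    hʳ i j = h i (suc j)

    u : ℕ → Carrier
    u j = (n C suc j) × h (suc j) (n ∸ j)

    nC0≡1 : ∀ n → n C 0 ≡ 1
    nC0≡1 n = ≡.trans (nCk≡nC[n∸k] {n = n} ℕ.z≤n) (nCn≡1 n)

    pascal : ∀ j → term (suc n) h (suc j) ≈ term n hˡ j + u j
    pascal j = trans
      (×-congˡ (≡.sym (nCk+nC[k+1]≡[n+1]C[k+1] n j)))
      (×-homo-+ _ (n C j) (n C suc j))

    u-inner : ∀ (j : Fin n) → u (toℕ j) ≈ term n hʳ (suc (toℕ j))
    u-inner j = ×-congʳ (n C suc (toℕ j))
      (reflexive (≡.cong (h (suc (toℕ j))) (ℕ.+-∸-assoc 1 (toℕ<n j))))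

    -- The `u j` with j < n are the terms of `hʳ` shifted by one. The surplus `u n` vanishes because
    -- `n C suc n` is 0.
    boundary : term (suc n) h 0 + ∑[ j ≤ n ] u (toℕ j) ≈ ∑[ j ≤ n ] term n hʳ (toℕ j)
    boundary = +-cong
      (×-congˡ (≡.trans (nC0≡1 (suc n)) (≡.sym (nC0≡1 n))))
      (begin
        ∑[ j ≤ n ] u (toℕ j)
          ≈⟨ ∑-last n u ⟩
        ∑[ j < n ] u (toℕ j) + u n
          ≈⟨ +-cong (sum-cong-≋ {n} u-inner) (×-congˡ (k>n⇒nCk≡0 (ℕ.n<1+n n))) ⟩
        ∑[ j < n ] term n hʳ (suc (toℕ j)) + 0#
          ≈⟨ +-identityʳ _ ⟩
        ∑[ j < n ] term n hʳ (suc (toℕ j)) ∎)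

-- Eulerian sequences in a commutative ring with a derivation.

record IsEulerianSequence {c ℓ} (R : CommutativeRing c ℓ) (∂ : CommutativeRing.Carrier R → CommutativeRing.Carrier R)
  (x : CommutativeRing.Carrier R) (A : ℕ → CommutativeRing.Carrier R) : Set (c ⊔ ℓ) where
  open CommutativeRing R
  open RawMonoidDefs +-rawMonoid using (_×_)
  field
    ∂-cong : ∀ {p q} → p ≈ q → ∂ p ≈ ∂ q
    ∂-+    : ∀ p q → ∂ (p + q) ≈ ∂ p + ∂ q
    ∂-*    : ∀ p q → ∂ (p * q) ≈ ∂ p * q + p * ∂ q
    ∂x≈1   : ∂ x ≈ 1#
    A-zero : A 0 ≈ 1#
    A-suc  : ∀ n → A (suc n) ≈ suc n × (x * A n) + (x * (1# - x)) * ∂ (A n)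

-- Only the laws of a derivation, `∂ x ≈ 1#` and the Eulerian recurrence enter, so coefficient lists
-- stay out of the argument.
module EulerianSequence {c ℓ} {R : CommutativeRing c ℓ} {∂ x A} (E : IsEulerianSequence R ∂ x A) where
  open CommutativeRing R hiding (zero)
  open IsEulerianSequence E
  open import Algebra.Properties.Ring ring using (+-identityʳ-unique; +-cancelʳ)
  open import Algebra.Properties.Semiring.Mult semiring
  open import Algebra.Properties.Semiring.Sum semiring
  open import Algebra.Solver.Ring.NaturalCoefficients.Default commutativeSemiring
  open import Relation.Binary.Reasoning.Setoid setoid
  open BinomialConvolution +-commutativeMonoid
  open HessenbergDeterminant R

  -- The semiring solver knows no subtraction, so 1 - x is an atom for it, tied to `x` by `w+x≈1`
  -- and `∂w+1≈0`.
  w : Carrier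
  w = 1# - x

  w+x≈1 : w + x ≈ 1#
  w+x≈1 = trans (+-assoc _ _ _) (trans (+-congˡ (-‿inverseˡ x)) (+-identityʳ 1#))

  ∂1≈0 : ∂ 1# ≈ 0#
  ∂1≈0 = +-identityʳ-unique (∂ 1#) (∂ 1#) (begin
    ∂ 1# + ∂ 1#           ≈⟨ +-cong (*-identityʳ _) (*-identityˡ _) ⟨
    ∂ 1# * 1# + 1# * ∂ 1# ≈⟨ ∂-* 1# 1# ⟨
    ∂ (1# * 1#)           ≈⟨ ∂-cong (*-identityˡ 1#) ⟩
    ∂ 1#                  ∎)

  ∂w+1≈0 : ∂ w + 1# ≈ 0#
  ∂w+1≈0 = begin
    ∂ w + 1#   ≈⟨ +-congˡ ∂x≈1 ⟨
    ∂ w + ∂ x  ≈⟨ ∂-+ w x ⟨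
    ∂ (w + x)  ≈⟨ ∂-cong w+x≈1 ⟩
    ∂ 1#       ≈⟨ ∂1≈0 ⟩
    0#         ∎

  ∂A₀≈0 : ∂ (A 0) ≈ 0#
  ∂A₀≈0 = trans (∂-cong A-zero) ∂1≈0

  -- Turns a multiple into a product whose factor `n × 1#` the solver can treat as a variable.
  ×≈* : ∀ n p → n × p ≈ (n × 1#) * p
  ×≈* n p = sym (trans (×-assoc-* n 1# p) (×-congʳ n (*-identityˡ p)))

  -- The operator of the Eulerian recurrence, with its weight `n` left free because products of the
  -- `A i` need other weights.
  step : ℕ → Carrier → Carrier
  step n p = (n × 1#) * (x * p) + (x * w) * ∂ p

  A-step : ∀ n → A (suc n) ≈ step (suc n) (A n)
  A-step n = trans (A-suc n) (+-congʳ (×≈* (suc n) _))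

  step-+ : ∀ n p q → step n (p + q) ≈ step n p + step n q
  step-+ n p q = trans
    (+-congˡ (*-congˡ (∂-+ p q)))
    (solve 7 (λ k x w p q p′ q′ →
        k :* (x :* (p :+ q)) :+ (x :* w) :* (p′ :+ q′) :=
        (k :* (x :* p) :+ (x :* w) :* p′) :+ (k :* (x :* q) :+ (x :* w) :* q′))
      refl (n × 1#) x w p q (∂ p) (∂ q))

  -- A twisted Leibniz rule: x(1 - x)∂ is a derivation, and the multiplication parts add their
  -- weights.
  step-* : ∀ m n p q → step m p * q + p * step n q ≈ step (m ℕ.+ n) (p * q)
  step-* m n p q = begin
    step m p * q + p * step n q
      ≈⟨ solve 8 (λ k l x w p q p′ q′ →
           (k :* (x :* p) :+ (x :* w) :* p′) :* q :+ p :* (l :* (x :* q) :+ (x :* w) :* q′) :=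
           (k :+ l) :* (x :* (p :* q)) :+ (x :* w) :* (p′ :* q :+ p :* q′))
           refl (m × 1#) (n × 1#) x w p q (∂ p) (∂ q) ⟩
    (m × 1# + n × 1#) * (x * (p * q)) + (x * w) * (∂ p * q + p * ∂ q)
      ≈⟨ +-cong (*-congʳ (sym (×-homo-+ 1# m n))) (*-congˡ (sym (∂-* p q))) ⟩
    step (m ℕ.+ n) (p * q) ∎

  -- The coefficient of zⁿ/n! in F², for F the exponential generating function of the `A i`.
  S : ℕ → Carrier
  S n = convolution n λ i j → A i * A j

  -- The recursion of `convolution` advances either factor. By `step-*` the weights i + 1 and j + 1
  -- add up to n + 2, the same for all terms.
  S-suc : ∀ n → S (suc n) ≈ step (suc (suc n)) (S n)
  S-suc n = begin
    S (suc n)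
      ≈⟨ convolution-+ n (λ i j → A (suc i) * A j) (λ i j → A i * A (suc j)) ⟨
    convolution n (λ i j → A (suc i) * A j + A i * A (suc j))
      ≈⟨ convolution-cong n (λ i j i+j≡n → trans
           (+-cong (*-congʳ (A-step i)) (*-congˡ (A-step j)))
           (trans (step-* (suc i) (suc j) (A i) (A j)) (+-congʳ (*-congʳ (×-congˡ (index i j i+j≡n)))))) ⟩
    convolution n (λ i j → step (suc (suc n)) (A i * A j))
      ≈⟨ convolution-homo (step (suc (suc n))) (step-+ (suc (suc n))) n (λ i j → A i * A j) ⟨
    step (suc (suc n)) (S n) ∎
    where
    index : ∀ i j → i ℕ.+ j ≡ n → suc i ℕ.+ suc j ≡ suc (suc n)
    index i j i+j≡n = ≡.cong suc (≡.trans (ℕ.+-suc i j) (≡.cong suc i+j≡n))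

  -- Differentiating `w` produces -`A n`, which moves to the right-hand side. The identity is a
  -- hypothesis because the induction for `riccati` uses its derivative at `n`.
  ∂-riccati : ∀ n → A (suc n) + w * A n ≈ S n → ∂ (A (suc n)) + w * ∂ (A n) ≈ ∂ (S n) + A n
  ∂-riccati n eq = sym (begin
    ∂ (S n) + A n
      ≈⟨ +-congʳ (∂-cong eq) ⟨
    ∂ (A (suc n) + w * A n) + A n
      ≈⟨ +-congʳ (trans (∂-+ _ _) (+-congˡ (∂-* w (A n)))) ⟩
    (∂ (A (suc n)) + (∂ w * A n + w * ∂ (A n))) + A n
      ≈⟨ solve 5 (λ b w′ a w a′ → (b :+ (w′ :* a :+ w :* a′)) :+ a :=
                   (b :+ w :* a′) :+ (w′ :+ con 1) :* a)
               refl (∂ (A (suc n))) (∂ w) (A n) w (∂ (A n)) ⟩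
    (∂ (A (suc n)) + w * ∂ (A n)) + (∂ w + 1#) * A n
      ≈⟨ +-congˡ (trans (*-congʳ ∂w+1≈0) (zeroˡ _)) ⟩
    (∂ (A (suc n)) + w * ∂ (A n)) + 0#
      ≈⟨ +-identityʳ _ ⟩
    ∂ (A (suc n)) + w * ∂ (A n) ∎)

  riccati : ∀ n → A (suc n) + w * A n ≈ S n
  riccati zero = begin
    A 1 + w * A 0
      ≈⟨ +-cong (A-step 0) (*-congˡ A-zero) ⟩
    step 1 (A 0) + w * 1#
      ≈⟨ +-congʳ (+-cong (*-congˡ (*-congˡ A-zero)) (*-congˡ ∂A₀≈0)) ⟩
    ((1# + 0#) * (x * 1#) + (x * w) * 0#) + w * 1#
      ≈⟨ solve 2 (λ x w → ((con 1 :+ con 0) :* (x :* con 1) :+ (x :* w) :* con 0) :+ w :* con 1 := w :+ x) refl x w ⟩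
    w + x
      ≈⟨ w+x≈1 ⟩
    1#
      ≈⟨ trans (*-cong A-zero A-zero) (*-identityˡ 1#) ⟨
    A 0 * A 0 ∎
  riccati (suc n) = begin
    A (suc (suc n)) + w * A (suc n)
      ≈⟨ +-cong (A-step (suc n)) (*-congˡ (A-step n)) ⟩
    step (suc (suc n)) b + w * step (suc n) a
      ≈⟨ solve 7 (λ k x w a a′ b b′ →
           ((con 1 :+ k) :* (x :* b) :+ (x :* w) :* b′) :+ w :* (k :* (x :* a) :+ (x :* w) :* a′) :=
           ((con 1 :+ k) :* (x :* b) :+ k :* (x :* (w :* a))) :+ (x :* w) :* (b′ :+ w :* a′))
           refl k x w a (∂ a) b (∂ b) ⟩
    (κ * (x * b) + k * (x * (w * a))) + (x * w) * (∂ b + w * ∂ a)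
      ≈⟨ +-congˡ (*-congˡ (∂-riccati n (riccati n))) ⟩
    (κ * (x * b) + k * (x * (w * a))) + (x * w) * (∂ (S n) + a)
      -- The summand `a` created by `∂-riccati` raises the weight of `w * a` from n + 1 to n + 2, so
      -- both parts of the left-hand side get the weight of `step (suc (suc n))`.
      ≈⟨ solve 6 (λ k x w a b s′ →
           ((con 1 :+ k) :* (x :* b) :+ k :* (x :* (w :* a))) :+ (x :* w) :* (s′ :+ a) :=
           (con 1 :+ k) :* (x :* (b :+ w :* a)) :+ (x :* w) :* s′)
           refl k x w a b (∂ (S n)) ⟩
    κ * (x * (b + w * a)) + (x * w) * ∂ (S n)
      ≈⟨ +-congʳ (*-congˡ (*-congˡ (riccati n))) ⟩
    step (suc (suc n)) (S n)
      ≈⟨ S-suc n ⟨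
    S (suc n) ∎
    where
    a b k κ : Carrier
    a = A n
    b = A (suc n)
    k = suc n × 1#
    κ = suc (suc n) × 1#

  Q : ℕ → Carrier
  Q n = convolution n λ i j → ∂ (A i) * A j

  -- Leibniz gives two mirror-image convolutions; this is the origin of the factor 2 in the matrix.
  ∂S : ∀ n → ∂ (S n) ≈ Q n + Q n
  ∂S n = begin
    ∂ (S n)
      ≈⟨ convolution-homo ∂ ∂-+ n (λ i j → A i * A j) ⟩
    convolution n (λ i j → ∂ (A i * A j))
      ≈⟨ convolution-cong n (λ i j _ → trans (∂-* (A i) (A j)) (+-congˡ (*-comm _ _))) ⟩
    convolution n (λ i j → ∂ (A i) * A j + ∂ (A j) * A i)
      ≈⟨ convolution-+ n (λ i j → ∂ (A i) * A j) (λ i j → ∂ (A j) * A i) ⟩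
    Q n + convolution n (λ i j → ∂ (A j) * A i)
      ≈⟨ +-congˡ (convolution-flip n (λ i j → ∂ (A i) * A j)) ⟩
    Q n + Q n ∎

  -- Obtained by expanding `Q n` as a sum in `∂-riccati`: the term j = 0 vanishes with `∂ (A 0)`,
  -- and the term j = n is `∂ (A n)` because `A 0` is 1.
  ∂A-recurrence : ∀ m → let n = suc m in
    ∂ (A (suc n)) ≈ A n + (∑[ j < m ] ((2 ℕ.* (n C suc (toℕ j))) × A (n ∸ suc (toℕ j)) * ∂ (A (suc (toℕ j))))
                           + (1# + x) * ∂ (A n))
  ∂A-recurrence m = +-cancelʳ (w * ∂ a) _ _ (begin
    ∂ (A (suc n)) + w * ∂ a
      ≈⟨ ∂-riccati n (riccati n) ⟩
    ∂ (S n) + a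
      ≈⟨ +-congʳ (trans (∂S n) (+-cong Q≈ Q≈)) ⟩
    ((sum q + ∂ a) + (sum q + ∂ a)) + a
      ≈⟨ solve 3 (λ s d a → ((s :+ d) :+ (s :+ d)) :+ a := (a :+ (s :+ s)) :+ (con 1 :+ con 1) :* d)
               refl (sum q) (∂ a) a ⟩
    (a + (sum q + sum q)) + (1# + 1#) * ∂ a
      -- One of the two units is rewritten as `w + x` so that `w * ∂ a` can be cancelled: 2 - (1 -
      -- x) = 1 + x is the diagonal entry.
      ≈⟨ +-cong (+-congˡ (trans (sym (∑-distrib-+ q q)) (sum-cong-≋ {m} double)))
                (*-congʳ (+-congˡ (sym w+x≈1))) ⟩
    (a + sum r) + (1# + (w + x)) * ∂ a
      ≈⟨ solve 5 (λ a s w x d → (a :+ s) :+ (con 1 :+ (w :+ x)) :* d :=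
                   (a :+ (s :+ (con 1 :+ x) :* d)) :+ w :* d)
               refl a (sum r) w x (∂ a) ⟩
    (a + (sum r + (1# + x) * ∂ a)) + w * ∂ a ∎)
    where
    n : ℕ
    n = suc m

    a : Carrier
    a = A n

    h : ℕ → ℕ → Carrier
    h i j = ∂ (A i) * A j

    q r : Fin m → Carrier
    q j = term n h (suc (toℕ j))
    r j = (2 ℕ.* (n C suc (toℕ j))) × A (n ∸ suc (toℕ j)) * ∂ (A (suc (toℕ j)))

    double : ∀ j → q j + q j ≈ r j
    double j = begin
      k × (d * b) + k × (d * b)
        ≈⟨ ×-homo-+ (d * b) k k ⟨
      (k ℕ.+ k) × (d * b)
        ≈⟨ ×-cong (≡.cong (k ℕ.+_) (≡.sym (ℕ.+-identityʳ k))) (*-comm d b) ⟩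
      (2 ℕ.* k) × (b * d)
        ≈⟨ ×-assoc-* (2 ℕ.* k) b d ⟨
      (2 ℕ.* k) × b * d ∎
      where
      k : ℕ
      k = n C suc (toℕ j)

      b d : Carrier
      b = A (n ∸ suc (toℕ j))
      d = ∂ (A (suc (toℕ j)))

    first : term n h 0 ≈ 0#
    first = trans (×-congʳ (n C 0) (trans (*-congʳ ∂A₀≈0) (zeroˡ _)))
                  (trans (×≈* (n C 0) 0#) (zeroʳ _))

    final : term n h n ≈ ∂ a
    final = begin
      (n C n) × (∂ a * A (n ∸ n))
        ≈⟨ ×-cong (nCn≡1 n) (*-congˡ (trans (reflexive (≡.cong A (ℕ.n∸n≡0 n))) A-zero)) ⟩
      1 × (∂ a * 1#)
        ≈⟨ trans (+-identityʳ _) (*-identityʳ _) ⟩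
      ∂ a ∎

    Q≈ : Q n ≈ sum q + ∂ a
    Q≈ = begin
      Q n
        ≈⟨ convolution-∑ n h ⟩
      term n h 0 + ∑[ j ≤ m ] term n h (suc (toℕ j))
        ≈⟨ +-cong first (∑-last m (λ j → term n h (suc j))) ⟩
      0# + (sum q + term n h n)
        ≈⟨ trans (+-identityˡ _) (+-congˡ final) ⟩
      sum q + ∂ a ∎

  -- Describes the entries by equations, so the induction on minors meets none of the Boolean tests
  -- in `entry`.
  record IsEulerianArray (e : Array) : Set ℓ where
    field
      isHessenberg : IsHessenberg e
      column₀      : ∀ i → e i 0 ≈ A i
      lower        : ∀ {i j} → suc j ℕ.< i → e i (suc j) ≈ (2 ℕ.* (i C suc j)) × A (i ∸ suc j)
      diagonal     : ∀ i → e (suc i) (suc i) ≈ 1# + x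

  module _ {e : Array} (isArray : IsEulerianArray e) where
    open IsEulerianArray isArray

    ∂A₁≈1 : ∂ (A 1) ≈ 1#
    ∂A₁≈1 = begin
      ∂ (A 1)
        ≈⟨ +-identityʳ _ ⟨
      ∂ (A 1) + 0#
        ≈⟨ +-congˡ (trans (*-congˡ ∂A₀≈0) (zeroʳ w)) ⟨
      ∂ (A 1) + w * ∂ (A 0)
        ≈⟨ ∂-riccati 0 (riccati 0) ⟩
      ∂ (A 0 * A 0) + A 0
        ≈⟨ +-cong (trans (∂-cong (trans (*-cong A-zero A-zero) (*-identityˡ 1#))) ∂1≈0) A-zero ⟩
      0# + 1#
        ≈⟨ +-identityˡ 1# ⟩
      1# ∎

    -- Strong induction, as the recurrence involves all smaller minors. The empty minor is 1 whereas
    -- `∂ (A 0)` is 0, so column 0 is treated apart: it supplies the summand `A n` of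
    -- `∂A-recurrence`.
    leading-eulerian : ∀ n → leading e (suc n) ≈ ∂ (A (suc n))
    leading-eulerian = <-rec _ go
      where
      go : ∀ n → (∀ {k} → k ℕ.< n → leading e (suc k) ≈ ∂ (A (suc k))) →
           leading e (suc n) ≈ ∂ (A (suc n))
      go zero    ih = begin
        leading e 1           ≈⟨ leading-recurrence 0 isHessenberg ⟩
        e 0 0 * 1# + 0#       ≈⟨ trans (+-identityʳ _) (*-identityʳ _) ⟩
        e 0 0                 ≈⟨ trans (column₀ 0) A-zero ⟩
        1#                    ≈⟨ ∂A₁≈1 ⟨
        ∂ (A 1)               ∎
      go (suc m) ih = begin
        leading e (suc n)
          ≈⟨ leading-recurrence n isHessenberg ⟩
        e n 0 * 1# + ∑[ j ≤ m ] (e n (suc (toℕ j)) * leading e (suc (toℕ j)))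
          ≈⟨ +-cong (trans (*-identityʳ _) (column₀ n))
                    (∑-last m (λ j → e n (suc j) * leading e (suc j))) ⟩
        A n + (∑[ j < m ] (e n (suc (toℕ j)) * leading e (suc (toℕ j))) + e n n * leading e n)
          ≈⟨ +-congˡ (+-cong
               (sum-cong-≋ {m} λ j →
                 *-cong (lower (ℕ.s≤s (toℕ<n j))) (ih (ℕ.m≤n⇒m≤1+n (toℕ<n j))))
               (*-cong (diagonal m) (ih (ℕ.n<1+n m)))) ⟩
        A n + (∑[ j < m ] ((2 ℕ.* (n C suc (toℕ j))) × A (n ∸ suc (toℕ j)) * ∂ (A (suc (toℕ j))))
               + (1# + x) * ∂ (A n))
          ≈⟨ ∂A-recurrence m ⟨
        ∂ (A (suc n)) ∎
        where
        n : ℕ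
        n = suc m

-- The commutative ring of integer polynomials.

open import Defs
open import Algebra.Structures _≈_ using (IsCommutativeRing)
open +-*-Solver
open ≡.≡-Reasoning

coeff-+ : ∀ p q k → coeff (p + q) k ≡ coeff p k ℤ.+ coeff q k
coeff-+ []      q       k       = ≡.sym (ℤ.+-identityˡ _)
coeff-+ (a ∷ p) []      k       = ≡.sym (ℤ.+-identityʳ _)
coeff-+ (a ∷ p) (b ∷ q) zero    = ≡.refl
coeff-+ (a ∷ p) (b ∷ q) (suc k) = coeff-+ p q k

coeff-neg : ∀ p k → coeff (- p) k ≡ ℤ.- coeff p k
coeff-neg []      k       = ≡.refl
coeff-neg (a ∷ p) zero    = ≡.refl
coeff-neg (a ∷ p) (suc k) = coeff-neg p k

coeff-· : ∀ c p k → coeff (c · p) k ≡ c ℤ.* coeff p k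
coeff-· c []      k       = ≡.sym (ℤ.*-zeroʳ c)
coeff-· c (a ∷ p) zero    = ≡.refl
coeff-· c (a ∷ p) (suc k) = coeff-· c p k

coeff-∷* : ∀ a p q k → coeff ((a ∷ p) * q) k ≡ a ℤ.* coeff q k ℤ.+ coeff (0ℤ ∷ p * q) k
coeff-∷* a p q k = ≡.trans (coeff-+ (a · q) _ k) (≡.cong (ℤ._+ _) (coeff-· a q k))

coeff-weighted : ∀ m p k → coeff (weighted m p) k ≡ + (m ℕ.+ k) ℤ.* coeff p k
coeff-weighted m []      k       = ≡.sym (ℤ.*-zeroʳ (+ (m ℕ.+ k)))
coeff-weighted m (a ∷ p) zero    = ≡.cong (λ n → + n ℤ.* a) (≡.sym (ℕ.+-identityʳ m))
coeff-weighted m (a ∷ p) (suc k) = ≡.trans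
  (coeff-weighted (suc m) p k) (≡.cong (λ n → + n ℤ.* coeff p k) (≡.sym (ℕ.+-suc m k)))

coeff-deriv : ∀ p k → coeff (deriv p) k ≡ + suc k ℤ.* coeff p (suc k)
coeff-deriv []      k = ≡.sym (ℤ.*-zeroʳ (+ suc k))
coeff-deriv (a ∷ p) k = coeff-weighted 1 p k

∷-cong : ∀ {p q} → p ≈ q → 0ℤ ∷ p ≈ 0ℤ ∷ q
∷-cong p≈q zero    = ≡.refl
∷-cong p≈q (suc k) = p≈q k

+-cong : ∀ {p p′ q q′} → p ≈ p′ → q ≈ q′ → p + q ≈ p′ + q′
+-cong {p} {p′} {q} {q′} p≈p′ q≈q′ k = begin
  coeff (p + q) k             ≡⟨ coeff-+ p q k ⟩
  coeff p k ℤ.+ coeff q k     ≡⟨ ≡.cong₂ ℤ._+_ (p≈p′ k) (q≈q′ k) ⟩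
  coeff p′ k ℤ.+ coeff q′ k   ≡⟨ coeff-+ p′ q′ k ⟨
  coeff (p′ + q′) k           ∎

+-assoc : ∀ p q r → (p + q) + r ≈ p + (q + r)
+-assoc p q r k = begin
  coeff ((p + q) + r) k                       ≡⟨ coeff-+ (p + q) r k ⟩
  coeff (p + q) k ℤ.+ coeff r k               ≡⟨ ≡.cong (ℤ._+ _) (coeff-+ p q k) ⟩
  coeff p k ℤ.+ coeff q k ℤ.+ coeff r k       ≡⟨ ℤ.+-assoc (coeff p k) _ _ ⟩
  coeff p k ℤ.+ (coeff q k ℤ.+ coeff r k)     ≡⟨ ≡.cong (λ z → coeff p k ℤ.+ z) (coeff-+ q r k) ⟨
  coeff p k ℤ.+ coeff (q + r) k               ≡⟨ coeff-+ p (q + r) k ⟨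
  coeff (p + (q + r)) k                       ∎

+-comm : ∀ p q → p + q ≈ q + p
+-comm p q k = begin
  coeff (p + q) k           ≡⟨ coeff-+ p q k ⟩
  coeff p k ℤ.+ coeff q k   ≡⟨ ℤ.+-comm (coeff p k) _ ⟩
  coeff q k ℤ.+ coeff p k   ≡⟨ coeff-+ q p k ⟨
  coeff (q + p) k           ∎

-‿cong : ∀ {p q} → p ≈ q → - p ≈ - q
-‿cong {p} {q} p≈q k = begin
  coeff (- p) k    ≡⟨ coeff-neg p k ⟩
  ℤ.- coeff p k    ≡⟨ ≡.cong ℤ.-_ (p≈q k) ⟩
  ℤ.- coeff q k    ≡⟨ coeff-neg q k ⟨
  coeff (- q) k    ∎

-‿inverseʳ : ∀ p → p + - p ≈ 0ₚ
-‿inverseʳ p k = begin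
  coeff (p + - p) k               ≡⟨ coeff-+ p (- p) k ⟩
  coeff p k ℤ.+ coeff (- p) k     ≡⟨ ≡.cong (λ z → coeff p k ℤ.+ z) (coeff-neg p k) ⟩
  coeff p k ℤ.+ (ℤ.- coeff p k)   ≡⟨ ℤ.+-inverseʳ (coeff p k) ⟩
  0ℤ                              ∎

*-zeroʳ : ∀ p → p * [] ≈ []
*-zeroʳ []      k       = ≡.refl
*-zeroʳ (a ∷ p) zero    = ≡.refl
*-zeroʳ (a ∷ p) (suc k) = *-zeroʳ p k

-- Multiplication recurses on its left factor; this is the mirror rule for the right factor, from
-- which commutativity follows by induction.
coeff-*∷ : ∀ p b q k → coeff (p * (b ∷ q)) k ≡ b ℤ.* coeff p k ℤ.+ coeff (0ℤ ∷ p * q) k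
coeff-*∷ []      b q zero    = ≡.sym (≡.trans (ℤ.+-identityʳ _) (ℤ.*-zeroʳ b))
coeff-*∷ []      b q (suc k) = ≡.sym (≡.trans (ℤ.+-identityʳ _) (ℤ.*-zeroʳ b))
coeff-*∷ (a ∷ p) b q zero    = ≡.cong (ℤ._+ 0ℤ) (ℤ.*-comm a b)
coeff-*∷ (a ∷ p) b q (suc k) = begin
  coeff ((a ∷ p) * (b ∷ q)) (suc k)
    ≡⟨ coeff-∷* a p (b ∷ q) (suc k) ⟩
  a ℤ.* coeff q k ℤ.+ coeff (p * (b ∷ q)) k
    ≡⟨ ≡.cong (λ z → a ℤ.* coeff q k ℤ.+ z) (coeff-*∷ p b q k) ⟩
  a ℤ.* coeff q k ℤ.+ (b ℤ.* coeff p k ℤ.+ coeff (0ℤ ∷ p * q) k)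
    ≡⟨ solve 3 (λ x y z → x :+ (y :+ z) := y :+ (x :+ z)) ≡.refl
             (a ℤ.* coeff q k) (b ℤ.* coeff p k) (coeff (0ℤ ∷ p * q) k) ⟩
  b ℤ.* coeff p k ℤ.+ (a ℤ.* coeff q k ℤ.+ coeff (0ℤ ∷ p * q) k)
    ≡⟨ ≡.cong (λ z → b ℤ.* coeff p k ℤ.+ z) (coeff-∷* a p q k) ⟨
  b ℤ.* coeff p k ℤ.+ coeff ((a ∷ p) * q) k ∎

*-comm : ∀ p q → p * q ≈ q * p
*-comm []      q k = ≡.sym (*-zeroʳ q k)
*-comm (a ∷ p) q k = begin
  coeff ((a ∷ p) * q) k
    ≡⟨ coeff-∷* a p q k ⟩
  a ℤ.* coeff q k ℤ.+ coeff (0ℤ ∷ p * q) k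
    ≡⟨ ≡.cong (λ z → a ℤ.* coeff q k ℤ.+ z) (∷-cong {p * q} {q * p} (*-comm p q) k) ⟩
  a ℤ.* coeff q k ℤ.+ coeff (0ℤ ∷ q * p) k
    ≡⟨ coeff-*∷ q a p k ⟨
  coeff (q * (a ∷ p)) k ∎

*-congˡ : ∀ p {q q′} → q ≈ q′ → p * q ≈ p * q′
*-congˡ []      q≈q′ k = ≡.refl
*-congˡ (a ∷ p) {q} {q′} q≈q′ k = begin
  coeff ((a ∷ p) * q) k
    ≡⟨ coeff-∷* a p q k ⟩
  a ℤ.* coeff q k ℤ.+ coeff (0ℤ ∷ p * q) k
    ≡⟨ ≡.cong₂ (λ b c → a ℤ.* b ℤ.+ c) (q≈q′ k)
               (∷-cong {p * q} {p * q′} (*-congˡ p {q} {q′} q≈q′) k) ⟩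
  a ℤ.* coeff q′ k ℤ.+ coeff (0ℤ ∷ p * q′) k
    ≡⟨ coeff-∷* a p q′ k ⟨
  coeff ((a ∷ p) * q′) k ∎

*-congʳ : ∀ q {p p′} → p ≈ p′ → p * q ≈ p′ * q
*-congʳ q {p} {p′} p≈p′ k = begin
  coeff (p * q) k    ≡⟨ *-comm p q k ⟩
  coeff (q * p) k    ≡⟨ *-congˡ q {p} {p′} p≈p′ k ⟩
  coeff (q * p′) k   ≡⟨ *-comm q p′ k ⟩
  coeff (p′ * q) k   ∎

*-cong : ∀ {p p′ q q′} → p ≈ p′ → q ≈ q′ → p * q ≈ p′ * q′
*-cong {p} {p′} {q} {q′} p≈p′ q≈q′ k =
  ≡.trans (*-congʳ q {p} {p′} p≈p′ k) (*-congˡ p′ {q} {q′} q≈q′ k)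

coeff-distribˡ : ∀ p q r k → coeff (p * (q + r)) k ≡ coeff (p * q) k ℤ.+ coeff (p * r) k
coeff-distribˡ []      q r k = ≡.refl
coeff-distribˡ (a ∷ p) q r k = begin
  coeff ((a ∷ p) * (q + r)) k
    ≡⟨ coeff-∷* a p (q + r) k ⟩
  a ℤ.* coeff (q + r) k ℤ.+ coeff (0ℤ ∷ p * (q + r)) k
    ≡⟨ ≡.cong₂ (λ b c → a ℤ.* b ℤ.+ c) (coeff-+ q r k) (shifted k) ⟩
  a ℤ.* (coeff q k ℤ.+ coeff r k) ℤ.+ (coeff (0ℤ ∷ p * q) k ℤ.+ coeff (0ℤ ∷ p * r) k)
    ≡⟨ solve 5 (λ a q r s t → a :* (q :+ r) :+ (s :+ t) := (a :* q :+ s) :+ (a :* r :+ t)) ≡.refl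
             a (coeff q k) (coeff r k) (coeff (0ℤ ∷ p * q) k) (coeff (0ℤ ∷ p * r) k) ⟩
  (a ℤ.* coeff q k ℤ.+ coeff (0ℤ ∷ p * q) k) ℤ.+ (a ℤ.* coeff r k ℤ.+ coeff (0ℤ ∷ p * r) k)
    ≡⟨ ≡.cong₂ ℤ._+_ (coeff-∷* a p q k) (coeff-∷* a p r k) ⟨
  coeff ((a ∷ p) * q) k ℤ.+ coeff ((a ∷ p) * r) k ∎
  where
  shifted : ∀ k → coeff (0ℤ ∷ p * (q + r)) k ≡ coeff (0ℤ ∷ p * q) k ℤ.+ coeff (0ℤ ∷ p * r) k
  shifted zero    = ≡.refl
  shifted (suc k) = coeff-distribˡ p q r k

coeff-distribʳ : ∀ r p q k → coeff ((p + q) * r) k ≡ coeff (p * r) k ℤ.+ coeff (q * r) k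
coeff-distribʳ r p q k = begin
  coeff ((p + q) * r) k                   ≡⟨ *-comm (p + q) r k ⟩
  coeff (r * (p + q)) k                   ≡⟨ coeff-distribˡ r p q k ⟩
  coeff (r * p) k ℤ.+ coeff (r * q) k     ≡⟨ ≡.cong₂ ℤ._+_ (*-comm r p k) (*-comm r q k) ⟩
  coeff (p * r) k ℤ.+ coeff (q * r) k     ∎

coeff-·* : ∀ c p q k → coeff ((c · p) * q) k ≡ c ℤ.* coeff (p * q) k
coeff-·* c []      q k = ≡.sym (ℤ.*-zeroʳ c)
coeff-·* c (a ∷ p) q k = begin
  coeff ((c ℤ.* a ∷ c · p) * q) k
    ≡⟨ coeff-∷* (c ℤ.* a) (c · p) q k ⟩
  c ℤ.* a ℤ.* coeff q k ℤ.+ coeff (0ℤ ∷ (c · p) * q) k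
    ≡⟨ ≡.cong (λ z → c ℤ.* a ℤ.* coeff q k ℤ.+ z) (shifted k) ⟩
  c ℤ.* a ℤ.* coeff q k ℤ.+ c ℤ.* coeff (0ℤ ∷ p * q) k
    ≡⟨ solve 4 (λ c a q s → c :* a :* q :+ c :* s := c :* (a :* q :+ s)) ≡.refl
             c a (coeff q k) (coeff (0ℤ ∷ p * q) k) ⟩
  c ℤ.* (a ℤ.* coeff q k ℤ.+ coeff (0ℤ ∷ p * q) k)
    ≡⟨ ≡.cong (c ℤ.*_) (coeff-∷* a p q k) ⟨
  c ℤ.* coeff ((a ∷ p) * q) k ∎
  where
  shifted : ∀ k → coeff (0ℤ ∷ (c · p) * q) k ≡ c ℤ.* coeff (0ℤ ∷ p * q) k
  shifted zero    = ≡.sym (ℤ.*-zeroʳ c)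
  shifted (suc k) = coeff-·* c p q k

coeff-0∷* : ∀ p q k → coeff ((0ℤ ∷ p) * q) k ≡ coeff (0ℤ ∷ p * q) k
coeff-0∷* p q k = ≡.trans (coeff-∷* 0ℤ p q k) (ℤ.+-identityˡ _)

*-assoc : ∀ p q r → (p * q) * r ≈ p * (q * r)
*-assoc []      q r k = ≡.refl
*-assoc (a ∷ p) q r k = begin
  coeff ((a · q + (0ℤ ∷ p * q)) * r) k
    ≡⟨ coeff-distribʳ r (a · q) (0ℤ ∷ p * q) k ⟩
  coeff ((a · q) * r) k ℤ.+ coeff ((0ℤ ∷ p * q) * r) k
    ≡⟨ ≡.cong₂ ℤ._+_ (coeff-·* a q r k) (coeff-0∷* (p * q) r k) ⟩
  a ℤ.* coeff (q * r) k ℤ.+ coeff (0ℤ ∷ (p * q) * r) k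
    ≡⟨ ≡.cong (λ z → a ℤ.* coeff (q * r) k ℤ.+ z)
              (∷-cong {(p * q) * r} {p * (q * r)} (*-assoc p q r) k) ⟩
  a ℤ.* coeff (q * r) k ℤ.+ coeff (0ℤ ∷ p * (q * r)) k
    ≡⟨ coeff-∷* a p (q * r) k ⟨
  coeff ((a ∷ p) * (q * r)) k ∎

*-identityˡ : ∀ p → 1ₚ * p ≈ p
*-identityˡ p k = begin
  coeff (1ₚ * p) k                              ≡⟨ coeff-∷* 1ℤ [] p k ⟩
  1ℤ ℤ.* coeff p k ℤ.+ coeff (0ℤ ∷ []) k        ≡⟨ ≡.cong₂ ℤ._+_ (ℤ.*-identityˡ (coeff p k)) (0∷[]≈0 k) ⟩
  coeff p k ℤ.+ 0ℤ                              ≡⟨ ℤ.+-identityʳ _ ⟩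
  coeff p k                                     ∎
  where
  -- The product leaves a trailing zero, which is the zero polynomial only up to `_≈_`.
  0∷[]≈0 : 0ℤ ∷ [] ≈ 0ₚ
  0∷[]≈0 zero    = ≡.refl
  0∷[]≈0 (suc k) = ≡.refl

isCommutativeRing : IsCommutativeRing _+_ _*_ -_ 0ₚ 1ₚ
isCommutativeRing = record
  { isRing = record
    { +-isAbelianGroup = record
      { isGroup = record
        { isMonoid = record
          { isSemigroup = record
            { isMagma = record
              { isEquivalence = record
                { refl  = λ k → ≡.refl
                ; sym   = λ p≈q k → ≡.sym (p≈q k)
                ; trans = λ p≈q q≈r k → ≡.trans (p≈q k) (q≈r k)
                }
              -- `_≈_` unfolds to equations between coefficients, from which the polynomials cannot
              -- be inferred; hence the explicit implicit arguments.
              ; ∙-cong = λ {p} {p′} {q} {q′} → +-cong {p} {p′} {q} {q′}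
              }
            ; assoc = +-assoc
            }
          ; identity = (λ p k → ≡.refl) , (λ p → +-comm p 0ₚ)
          }
        ; inverse = (λ p k → ≡.trans (+-comm (- p) p k) (-‿inverseʳ p k)) , -‿inverseʳ
        ; ⁻¹-cong = λ {p} {q} → -‿cong {p} {q}
        }
      ; comm = +-comm
      }
    ; *-cong     = λ {p} {p′} {q} {q′} → *-cong {p} {p′} {q} {q′}
    ; *-assoc    = *-assoc
    ; *-identity = *-identityˡ , λ p k → ≡.trans (*-comm p 1ₚ k) (*-identityˡ p k)
    ; distrib    = (λ p q r k → ≡.trans (coeff-distribˡ p q r k) (≡.sym (coeff-+ (p * q) (p * r) k)))
                 , (λ r p q k → ≡.trans (coeff-distribʳ r p q k) (≡.sym (coeff-+ (p * r) (q * r) k)))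
    }
  ; *-comm = *-comm
  }

polynomialRing : CommutativeRing _ _
polynomialRing = record { isCommutativeRing = isCommutativeRing }

-- The formal derivative as a derivation.

deriv-cong : ∀ {p q} → p ≈ q → deriv p ≈ deriv q
deriv-cong {p} {q} p≈q k = begin
  coeff (deriv p) k               ≡⟨ coeff-deriv p k ⟩
  + suc k ℤ.* coeff p (suc k)     ≡⟨ ≡.cong (+ suc k ℤ.*_) (p≈q (suc k)) ⟩
  + suc k ℤ.* coeff q (suc k)     ≡⟨ coeff-deriv q k ⟨
  coeff (deriv q) k               ∎

deriv-+ : ∀ p q → deriv (p + q) ≈ deriv p + deriv q
deriv-+ p q k = begin
  coeff (deriv (p + q)) k
    ≡⟨ coeff-deriv (p + q) k ⟩
  + suc k ℤ.* coeff (p + q) (suc k)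
    ≡⟨ ≡.cong (+ suc k ℤ.*_) (coeff-+ p q (suc k)) ⟩
  + suc k ℤ.* (coeff p (suc k) ℤ.+ coeff q (suc k))
    ≡⟨ ℤ.*-distribˡ-+ (+ suc k) (coeff p (suc k)) (coeff q (suc k)) ⟩
  + suc k ℤ.* coeff p (suc k) ℤ.+ + suc k ℤ.* coeff q (suc k)
    ≡⟨ ≡.cong₂ ℤ._+_ (coeff-deriv p k) (coeff-deriv q k) ⟨
  coeff (deriv p) k ℤ.+ coeff (deriv q) k
    ≡⟨ coeff-+ (deriv p) (deriv q) k ⟨
  coeff (deriv p + deriv q) k ∎

-- The product rule for a + x p, the case on which the general rule is built.
deriv-∷ : ∀ a p → deriv (a ∷ p) ≈ p + (0ℤ ∷ deriv p)
deriv-∷ a p k = begin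
  coeff (deriv (a ∷ p)) k                   ≡⟨ coeff-deriv (a ∷ p) k ⟩
  + suc k ℤ.* coeff p k                     ≡⟨ split k ⟩
  coeff p k ℤ.+ coeff (0ℤ ∷ deriv p) k      ≡⟨ coeff-+ p (0ℤ ∷ deriv p) k ⟨
  coeff (p + (0ℤ ∷ deriv p)) k              ∎
  where
  split : ∀ k → + suc k ℤ.* coeff p k ≡ coeff p k ℤ.+ coeff (0ℤ ∷ deriv p) k
  split zero    = ≡.trans (ℤ.*-identityˡ _) (≡.sym (ℤ.+-identityʳ _))
  split (suc k) = ≡.trans (ℤ.suc-* (+ suc k) _) (≡.cong (λ z → coeff p (suc k) ℤ.+ z) (≡.sym (coeff-deriv p k)))

-- Induction on `p` with (a + x p) q = a q + x (p q): `deriv-∷` differentiates the second summand,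
-- and `shifted` applies the induction hypothesis to `p * q`.
deriv-* : ∀ p q → deriv (p * q) ≈ deriv p * q + p * deriv q
deriv-* []      q k = ≡.refl
deriv-* (a ∷ p) q k = begin
  coeff (deriv ((a ∷ p) * q)) k
    ≡⟨ coeff-deriv ((a ∷ p) * q) k ⟩
  + suc k ℤ.* coeff ((a ∷ p) * q) (suc k)
    ≡⟨ ≡.cong (+ suc k ℤ.*_) (coeff-∷* a p q (suc k)) ⟩
  + suc k ℤ.* (a ℤ.* coeff q (suc k) ℤ.+ coeff (p * q) k)
    ≡⟨ solve 4 (λ n a u v → n :* (a :* u :+ v) := n :* v :+ a :* (n :* u)) ≡.refl
             (+ suc k) a (coeff q (suc k)) (coeff (p * q) k) ⟩
  + suc k ℤ.* coeff (p * q) k ℤ.+ a ℤ.* (+ suc k ℤ.* coeff q (suc k))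
    ≡⟨ ≡.cong₂ (λ b c → b ℤ.+ a ℤ.* c) (coeff-deriv (0ℤ ∷ p * q) k) (coeff-deriv q k) ⟨
  coeff (deriv (0ℤ ∷ p * q)) k ℤ.+ a ℤ.* coeff (deriv q) k
    ≡⟨ ≡.cong (ℤ._+ a ℤ.* coeff (deriv q) k) (≡.trans (deriv-∷ 0ℤ (p * q) k) (coeff-+ (p * q) _ k)) ⟩
  coeff (p * q) k ℤ.+ coeff (0ℤ ∷ deriv (p * q)) k ℤ.+ a ℤ.* coeff (deriv q) k
    ≡⟨ ≡.cong (λ b → coeff (p * q) k ℤ.+ b ℤ.+ a ℤ.* coeff (deriv q) k) (shifted k) ⟩
  coeff (p * q) k ℤ.+ (coeff (0ℤ ∷ deriv p * q) k ℤ.+ coeff (0ℤ ∷ p * deriv q) k) ℤ.+ a ℤ.* coeff (deriv q) k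
    ≡⟨ solve 4 (λ u v w x → u :+ (v :+ w) :+ x := (u :+ v) :+ (x :+ w)) ≡.refl
             (coeff (p * q) k) (coeff (0ℤ ∷ deriv p * q) k) (coeff (0ℤ ∷ p * deriv q) k) (a ℤ.* coeff (deriv q) k) ⟩
  (coeff (p * q) k ℤ.+ coeff (0ℤ ∷ deriv p * q) k) ℤ.+ (a ℤ.* coeff (deriv q) k ℤ.+ coeff (0ℤ ∷ p * deriv q) k)
    ≡⟨ ≡.cong₂ ℤ._+_ derivˡ (coeff-∷* a p (deriv q) k) ⟨
  coeff (deriv (a ∷ p) * q) k ℤ.+ coeff ((a ∷ p) * deriv q) k
    ≡⟨ coeff-+ (deriv (a ∷ p) * q) _ k ⟨
  coeff (deriv (a ∷ p) * q + (a ∷ p) * deriv q) k ∎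
  where
  shifted : ∀ k → coeff (0ℤ ∷ deriv (p * q)) k ≡ coeff (0ℤ ∷ deriv p * q) k ℤ.+ coeff (0ℤ ∷ p * deriv q) k
  shifted zero    = ≡.refl
  shifted (suc k) = ≡.trans (deriv-* p q k) (coeff-+ (deriv p * q) _ k)

  derivˡ : coeff (deriv (a ∷ p) * q) k ≡ coeff (p * q) k ℤ.+ coeff (0ℤ ∷ deriv p * q) k
  derivˡ = begin
    coeff (deriv (a ∷ p) * q) k
      ≡⟨ *-congʳ q {deriv (a ∷ p)} {p + (0ℤ ∷ deriv p)} (deriv-∷ a p) k ⟩
    coeff ((p + (0ℤ ∷ deriv p)) * q) k
      ≡⟨ coeff-distribʳ q p (0ℤ ∷ deriv p) k ⟩
    coeff (p * q) k ℤ.+ coeff ((0ℤ ∷ deriv p) * q) k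
      ≡⟨ ≡.cong (λ z → coeff (p * q) k ℤ.+ z) (coeff-0∷* (deriv p) q k) ⟩
    coeff (p * q) k ℤ.+ coeff (0ℤ ∷ deriv p * q) k ∎

-- The Eulerian polynomials and their matrix.

open RawMonoidDefs (CommutativeRing.+-rawMonoid polynomialRing) using (_×_)

-- Links the scalar multiples in the definitions to the repeated addition of the abstract
-- development.
·≈× : ∀ n p → + n · p ≈ n × p
·≈× n p k = ≡.trans (coeff-· (+ n) p k) (≡.sym (coeff-× n))
  where
  coeff-× : ∀ n → coeff (n × p) k ≡ + n ℤ.* coeff p k
  coeff-× zero    = ≡.refl
  coeff-× (suc n) = begin
    coeff (p + n × p) k                   ≡⟨ coeff-+ p (n × p) k ⟩
    coeff p k ℤ.+ coeff (n × p) k         ≡⟨ ≡.cong (λ z → coeff p k ℤ.+ z) (coeff-× n) ⟩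
    coeff p k ℤ.+ + n ℤ.* coeff p k       ≡⟨ ℤ.suc-* (+ n) (coeff p k) ⟨
    + suc n ℤ.* coeff p k                 ∎

eulerian-isEulerianSequence : IsEulerianSequence polynomialRing deriv X eulerian
eulerian-isEulerianSequence = record
  { ∂-cong = λ {p} {q} → deriv-cong {p} {q}
  ; ∂-+    = deriv-+
  ; ∂-*    = deriv-*
  ; ∂x≈1   = λ k → ≡.refl
  ; A-zero = λ k → ≡.refl
  ; A-suc  = λ n → +-cong {+ suc n · (X * eulerian n)} {suc n × (X * eulerian n)}
                          {(X * (1ₚ - X)) * deriv (eulerian n)} {(X * (1ₚ - X)) * deriv (eulerian n)}
                          (·≈× (suc n) (X * eulerian n)) (λ k → ≡.refl)
  }

open HessenbergDeterminant polynomialRing using (IsHessenberg)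
open EulerianSequence eulerian-isEulerianSequence using (IsEulerianArray; leading-eulerian)

entry-isHessenberg : IsHessenberg entry
entry-isHessenberg = record { superdiagonal = superdiagonal ; beyond = beyond }
  where
  superdiagonal : ∀ i → entry i (suc i) ≈ - 1ₚ
  superdiagonal i
    -- The tests in `entry` are the Boolean parts of `ℕ.<?` and `ℕ.≟`. The last one has already
    -- reduced from `suc i ≡ᵇ suc i` to `i ≡ᵇ i`.
    rewrite dec-false (suc i ℕ.<? i) (ℕ.<-asym (ℕ.n<1+n i))
          | dec-false (suc i ℕ.≟ i) ℕ.1+n≢n
          | dec-true (i ℕ.≟ i) ≡.refl = λ k → ≡.refl

  beyond : ∀ {i j} → suc i ℕ.< j → entry i j ≈ 0ₚ
  beyond {i} {suc j} 1+i<1+j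
    rewrite dec-false (suc j ℕ.<? i) (ℕ.<-asym (ℕ.<-trans (ℕ.n<1+n i) 1+i<1+j))
          | dec-false (suc j ℕ.≟ i) (ℕ.>⇒≢ (ℕ.<-trans (ℕ.n<1+n i) 1+i<1+j))
          | dec-false (suc j ℕ.≟ suc i) (ℕ.>⇒≢ 1+i<1+j) = λ k → ≡.refl

entry-isEulerianArray : IsEulerianArray entry
entry-isEulerianArray = record
  { isHessenberg = entry-isHessenberg
  ; column₀      = λ i k → ≡.refl
  ; lower        = lower
  ; diagonal     = diagonal
  }
  where
  lower : ∀ {i j} → suc j ℕ.< i → entry i (suc j) ≈ (2 ℕ.* (i C suc j)) × eulerian (i ∸ suc j)
  lower {i} {j} 1+j<i rewrite dec-true (suc j ℕ.<? i) 1+j<i =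
    ·≈× (2 ℕ.* (i C suc j)) (eulerian (i ∸ suc j))

  diagonal : ∀ i → entry (suc i) (suc i) ≈ 1ₚ + X
  diagonal i
    rewrite dec-false (suc i ℕ.<? suc i) (ℕ.<-irrefl ≡.refl)
          | dec-true (i ℕ.≟ i) ≡.refl = λ k → ≡.refl

theorem2p2 : (n : ℕ) → n ≥ 1 → deriv (eulerian n) ≈ det (eulerianMatrix n)
-- `det (eulerianMatrix (suc n))` unfolds to `leading entry (suc n)`. At 0 the empty determinant 1
-- would differ from the derivative 0.
theorem2p2 (suc n) _ k = ≡.sym (leading-eulerian entry-isEulerianArray n k)
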